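{- Let $\mathcal F$ be a flag of a finite abelian group or of a finite field extension, of degree $n$. Then for every corner $(i,j)$ of $T_{\mathcal F}$ we have $T_{\mathcal F}(i,j)\ge i+j$.
   Context: Let $[n]=\{0,\dots,n-1\}$. A flag of a finite abelian group $G$ of order $n$ (written multiplicatively) is a chain of subsets $\{1\}=F_0\subset\cdots\subset F_{n-1}=G$ with $|F_i|=i+1$; a flag of a degree $n$ field extension $L/K$ is a chain of $K$-subspaces $K=F_0\subset\cdots\subset F_{n-1}=L$ with $\dim_KF_i=i+1$. The flag type of a flag is $T_{\mathcal F}:[n]\times[n]\to[n]$, $T_{\mathcal F}(i,j)=\min\{k: F_iF_j\subseteq F_k\}$, where $F_iF_j$ is the set of products (groups) or the $K$-span of products (fields). For $0<i,j<n$, $(i,j)$ is a corner of $T_{\mathcal F}$ if $T_{\mathcal F}(i-1,j)<T_{\mathcal F}(i,j)$ and $T_{\mathcal F}(i,j-1)<T_{\mathcal F}(i,j)$. -}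

module Defs where

open import Level using (Level; _⊔_) renaming (suc to lsuc)
open import Data.Nat using (ℕ; zero; suc; _<_; _∸_)
import Data.Fin as Fin
open Fin using (Fin)
open import Data.Product using (Σ; ∃; _×_; _,_)
open import Relation.Nullary using (¬_)
open import Relation.Unary using (Pred)
open import Function.Bundles using (_⇔_)
open import Algebra.Bundles using (AbelianGroup; CommutativeRing)

-- Generic notion of a flag type, for any "product of subsets" relation.
--
-- `Prod i j k` stands for  F_i F_j ⊆ F_k .
-- `IsFlagType Prod n i j k` says  T(i,j) = k , i.e. k is the least
-- index in [n] with F_i F_j ⊆ F_k.

IsFlagType : ∀ {p} → (ℕ → ℕ → ℕ → Set p) → ℕ → ℕ → ℕ → ℕ → Set p
IsFlagType Prod n i j k =
  k < n × Prod i j k × (∀ k′ → k′ < k → ¬ Prod i j k′)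

IsCorner : ∀ {p} → (ℕ → ℕ → ℕ → Set p) → ℕ → ℕ → ℕ → ℕ → Set p
IsCorner Prod n i j k =
  0 < i × i < n × 0 < j × j < n × IsFlagType Prod n i j k ×
  (∀ k₁ → IsFlagType Prod n (i ∸ 1) j k₁ → k₁ < k) ×
  (∀ k₂ → IsFlagType Prod n i (j ∸ 1) k₂ → k₂ < k)

module _ {c ℓ} (G : AbelianGroup c ℓ) where
  open AbelianGroup G

  HasOrder : ℕ → Set (c ⊔ ℓ)
  HasOrder n = Σ (Fin n → Carrier) λ e →
    (∀ a b → e a ≈ e b → a ≡F b) × (∀ x → ∃ λ a → x ≈ e a)
    where open import Relation.Binary.PropositionalEquality renaming (_≡_ to _≡F_)

  HasCard : ∀ {p} → Pred Carrier p → ℕ → Set (c ⊔ ℓ ⊔ p)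
  HasCard S m = Σ (Fin m → Carrier) λ e →
    (∀ a b → e a ≈ e b → a ≡F b) × (∀ x → S x ⇔ (∃ λ a → x ≈ e a))
    where open import Relation.Binary.PropositionalEquality renaming (_≡_ to _≡F_)

  record IsGroupFlag {p} (n : ℕ) (F : ℕ → Pred Carrier p) : Set (c ⊔ ℓ ⊔ p) where
    field
      card   : ∀ i → i < n → HasCard (F i) (suc i)
      nested : ∀ i → suc i < n → ∀ x → F i x → F (suc i) x
      bottom : ∀ x → F 0 x ⇔ (x ≈ ε)
      top    : ∀ x → F (n ∸ 1) x

  GProd : ∀ {p} → (ℕ → Pred Carrier p) → ℕ → ℕ → ℕ → Set (c ⊔ p)
  GProd F i j k = ∀ x y → F i x → F j y → F k (x ∙ y)

module _ {c ℓ} (L : CommutativeRing c ℓ) where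
  open CommutativeRing L

  IsField : Set (c ⊔ ℓ)
  IsField = (¬ (1# ≈ 0#)) × (∀ x → ¬ (x ≈ 0#) → ∃ λ y → x * y ≈ 1#)

  record IsSubfield {k} (K : Pred Carrier k) : Set (c ⊔ ℓ ⊔ k) where
    field
      resp  : ∀ {x y} → x ≈ y → K x → K y
      zero∈ : K 0#
      one∈  : K 1#
      +∈    : ∀ {x y} → K x → K y → K (x + y)
      -∈    : ∀ {x} → K x → K (- x)
      *∈    : ∀ {x y} → K x → K y → K (x * y)
      inv∈  : ∀ {x} → K x → ¬ (x ≈ 0#) → ∃ λ y → K y × (x * y ≈ 1#)

  record IsSubspace {k p} (K : Pred Carrier k) (V : Pred Carrier p)
         : Set (c ⊔ ℓ ⊔ k ⊔ p) where
    field
      resp  : ∀ {x y} → x ≈ y → V x → V y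
      zero∈ : V 0#
      +∈    : ∀ {x y} → V x → V y → V (x + y)
      smul∈ : ∀ {a x} → K a → V x → V (a * x)

  lincomb : ∀ d → (Fin d → Carrier) → (Fin d → Carrier) → Carrier
  lincomb zero    cs v = 0#
  lincomb (suc d) cs v = cs Fin.zero * v Fin.zero
                         + lincomb d (λ m → cs (Fin.suc m)) (λ m → v (Fin.suc m))

  IsBasis : ∀ {k p} → Pred Carrier k → Pred Carrier p → ∀ d →
            (Fin d → Carrier) → Set (c ⊔ ℓ ⊔ k ⊔ p)
  IsBasis K V d v =
    (∀ m → V (v m)) ×
    (∀ (cs : Fin d → Carrier) → (∀ m → K (cs m)) →
       lincomb d cs v ≈ 0# → ∀ m → cs m ≈ 0#) ×
    (∀ x → V x → ∃ λ (cs : Fin d → Carrier) →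
       (∀ m → K (cs m)) × (x ≈ lincomb d cs v))

  HasDim : ∀ {k p} → Pred Carrier k → Pred Carrier p → ℕ → Set (c ⊔ ℓ ⊔ k ⊔ p)
  HasDim K V d = ∃ λ (v : Fin d → Carrier) → IsBasis K V d v

  Univ : Pred Carrier Level.zero
  Univ _ = Data.Unit.⊤
    where import Data.Unit

  record IsFieldFlag {k p} (K : Pred Carrier k) (n : ℕ) (F : ℕ → Pred Carrier p)
         : Set (c ⊔ ℓ ⊔ k ⊔ p) where
    field
      subspace : ∀ i → i < n → IsSubspace K (F i)
      dim      : ∀ i → i < n → HasDim K (F i) (suc i)
      nested   : ∀ i → suc i < n → ∀ x → F i x → F (suc i) x
      bottom   : ∀ x → F 0 x ⇔ K x
      top      : ∀ x → F (n ∸ 1) x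

  -- F_i F_j ⊆ F_k, where F_i F_j is the K-span of products; since F_k is
  -- a K-subspace this is: all products x*y lie in F_k.
  FProd : ∀ {p} → (ℕ → Pred Carrier p) → ℕ → ℕ → ℕ → Set (c ⊔ p)
  FProd F i j k = ∀ x y → F i x → F j y → F k (x * y)

{-# OPTIONS --safe #-}
module Submission where

-- At a corner T(i,j) = k there are x ∈ F i, y ∈ F j with x y ∉ W = F (k − 1), while U = F (i − 1)
-- and V = F (j − 1) satisfy U y ⊆ W and A V ⊆ W, where A is spanned by x and U.  These inclusions
-- imply dim U + dim V ≤ dim W, i.e. i + j ≤ k: this is the Kemperman–Scherk theorem on
-- sumsets with a uniquely represented element, together with its linear analogue.  It follows by
-- induction on dim V from a Dyson transform: for e ∈ A put t = e / y and replace U by U + V t and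
-- V by {v ∈ V : v t ∈ A}.  The dimensions keep their sum, and V shrinks unless V t ⊆ A.  If
-- V t ⊆ A for every e ∈ A, then for 0 ≠ v ∈ V multiplication by v / y is an injection A → A,
-- hence onto, so x ∈ A v / y and x y ∈ A v ⊆ W, a contradiction.

open import Defs
open import Level using (Level; _⊔_; Lift) renaming (suc to lsuc)
open import Data.Fin using (Fin) renaming (zero to fzero; suc to fsuc)
open import Data.Fin.Properties using (0≢1+n; suc-injective)
open import Data.List using (List; []; _∷_; _++_; map; length; tabulate)
open import Data.List.Properties using (length-++; length-map; length-tabulate)
open import Data.List.Relation.Unary.All as All using (All; []; _∷_)
open import Data.List.Relation.Unary.All.Properties as Allₚ using (map⁺; ++⁺)
open import Data.List.Relation.Unary.Any as Any using (Any; here; there)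
import Data.List.Relation.Unary.Any.Properties as Anyₚ
open import Data.Nat using (ℕ; zero; suc; _+_; _∸_; _≤_; _<_; s≤s; z≤n; s≤s⁻¹; _≤?_)
open import Data.Nat.Induction using (<-rec)
open import Data.Nat.Properties as ℕ
  using (m≤n+m; ≤-trans; ≤-reflexive; ≤-refl; 1+n≰n; <-trans; n<1+n; m≤n⇒m<n∨m≡n)
open import Data.Product using (∃; _×_; _,_; proj₁; proj₂)
open import Data.Sum using (_⊎_; inj₁; inj₂)
open import Data.Unit using (⊤)
open import Function.Base using (_∘_)
open import Function.Bundles using (_⇔_; mk⇔; module Equivalence)
open import Relation.Binary.PropositionalEquality as ≡ using (_≡_; refl; cong; subst)
open import Relation.Nullary using (¬_; yes; no; contradiction)
open import Relation.Nullary.Decidable using (¬¬-excluded-middle; decidable-stable)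
open import Relation.Unary using (Pred)
open import Algebra.Bundles using (AbelianGroup; CommutativeMonoid; CommutativeRing)

-- Classical reasoning under double negation.

-- Neither the scalar field nor the flags come with decidable equality or membership, but the
-- bound is decidable, so the argument runs in the double-negation monad.
private
  _>>=_ : ∀ {a b} {A : Set a} {B : Set b} → ¬ ¬ A → (A → ¬ ¬ B) → ¬ ¬ B
  (m >>= f) k = m λ a → f a k

  pure : ∀ {a} {A : Set a} → A → ¬ ¬ A
  pure a k = k a

-- This replaces the choice of a counterexample: a failed inclusion between spans yields a generator
-- at which it fails.
¬All⇒¬¬Any¬ : ∀ {a p} {A : Set a} {P : Pred A p} (xs : List A) →
              ¬ All P xs → ¬ ¬ Any (¬_ ∘ P) xs
¬All⇒¬¬Any¬ []       ¬all = contradiction [] ¬all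
¬All⇒¬¬Any¬ {P = P} (x ∷ xs) ¬all = ¬¬-excluded-middle {A = P x} >>= λ where
  (no ¬px) → pure (here ¬px)
  (yes px) → ¬All⇒¬¬Any¬ xs (λ pxs → ¬all (px ∷ pxs)) >>= λ any → pure (there any)

-- Span structures, independence and translation.

-- `exchange` makes `Span` a matroid closure and `modular` makes its lattice of flats modular.
-- For groups the span of a list is its set of entries, and for fields it is the linear span.
record SpanStructure {c ℓ} (M : CommutativeMonoid c ℓ) s : Set (c ⊔ ℓ ⊔ lsuc s) where
  open CommutativeMonoid M
  field
    Span       : List Carrier → Pred Carrier s
    span-resp  : ∀ {xs x y} → x ≈ y → Span xs x → Span xs y
    span-here  : ∀ {x xs} → Span (x ∷ xs) x
    span-there : ∀ {x xs y} → Span xs y → Span (x ∷ xs) y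
    span-⊆     : ∀ {xs ys z} → All (Span ys) xs → Span xs z → Span ys z
    exchange   : ∀ {x y xs} → Span (y ∷ xs) x → ¬ Span xs x → Span (x ∷ xs) y
    modular    : ∀ xs {ys x} → Span (xs ++ ys) x → ¬ Span xs x →
                 ∃ λ y → Span ys y × Span (y ∷ xs) x
    span-map   : ∀ {xs x} t → Span xs x → Span (map (_∙ t) xs) (x ∙ t)
    invertible : ∀ {x} → ¬ Span [] x → ∃ λ y → x ∙ y ≈ ε

module _ {c ℓ s} {M : CommutativeMonoid c ℓ} (S : SpanStructure M s) where
  open CommutativeMonoid M renaming (refl to ≈-refl; sym to ≈-sym; trans to ≈-trans)
  open import Algebra.Properties.CommutativeSemigroup commutativeSemigroup
    using (x∙yz≈z∙yx; xy∙z≈zy∙x; xy∙z≈y∙zx; interchange)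
  open SpanStructure S

  Independent : List Carrier → Set s
  Independent []       = Lift s ⊤
  Independent (x ∷ xs) = ¬ Span xs x × Independent xs

  span-refl : ∀ xs → All (Span xs) xs
  span-refl []       = []
  span-refl (x ∷ xs) = span-here ∷ All.map span-there (span-refl xs)

  span-++ˡ : ∀ xs ys → All (Span (xs ++ ys)) xs
  span-++ˡ xs ys = Allₚ.++⁻ˡ xs (span-refl (xs ++ ys))

  span-++ʳ : ∀ xs ys → All (Span (xs ++ ys)) ys
  span-++ʳ xs ys = Allₚ.++⁻ʳ xs (span-refl (xs ++ ys))

  span-[] : ∀ {xs x} → Span [] x → Span xs x
  span-[] = span-⊆ []

  -- Multiplication by b carries spans to spans, so an inclusion of products can be tested on
  -- generators.
  span-∙ : ∀ {us ws a b} → All (λ u → Span ws (u ∙ b)) us → Span us a → Span ws (a ∙ b)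
  span-∙ {b = b} us⊆ a∈ = span-⊆ (map⁺ us⊆) (span-map b a∈)

  span-∙∙ : ∀ {us vs ws a b} → All (λ u → All (λ v → Span ws (u ∙ v)) vs) us →
            Span us a → Span vs b → Span ws (a ∙ b)
  span-∙∙ usvs⊆ a∈ b∈ = span-∙
    (All.map (λ uvs⊆ → span-resp (comm _ _) (span-∙ (All.map (span-resp (comm _ _)) uvs⊆) b∈)) usvs⊆)
    a∈

  cancel : ∀ {s t} → s ∙ t ≈ ε → ∀ x → (x ∙ s) ∙ t ≈ x
  cancel st≈ε x = ≈-trans (assoc x _ _) (≈-trans (∙-congˡ st≈ε) (identityʳ x))

  span-unmap : ∀ {s t xs x} → s ∙ t ≈ ε → Span (map (_∙ s) xs) x → Span xs (x ∙ t)
  span-unmap st≈ε = span-∙ (map⁺ (All.map (span-resp (≈-sym (cancel st≈ε _))) (span-refl _)))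

  independent-map : ∀ {s t} xs → s ∙ t ≈ ε → Independent xs → Independent (map (_∙ s) xs)
  independent-map []       st≈ε _            = _
  independent-map (x ∷ xs) st≈ε (x∉ , indep) =
    (λ x∈ → x∉ (span-resp (cancel st≈ε x) (span-unmap st≈ε x∈))) , independent-map xs st≈ε indep

  -- `¬ Span [] x` says that x ≠ 0 over a field and is vacuous in a group; in both cases it is the
  -- hypothesis of `invertible`.
  nonzero : ∀ xs → Independent xs → All (¬_ ∘ Span []) xs
  nonzero []       _            = []
  nonzero (x ∷ xs) (x∉ , indep) = x∉ ∘ span-[] ∷ nonzero xs indep

  -- Steinitz exchange.

  replace : ∀ zs {xs x} → Span (zs ++ xs) x → ¬ Span xs x →
            ¬ ¬ ∃ λ zs′ → suc (length zs′) ≡ length zs × All (Span (zs′ ++ x ∷ xs)) zs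
  replace []       x∈ x∉ = contradiction x∈ x∉
  replace (z ∷ zs) {xs} {x} x∈ x∉ = ¬¬-excluded-middle {A = Span (zs ++ xs) x} >>= λ where
    -- Here x cannot be spanned without z, so `exchange` recovers z from x and z is dropped.
    -- Otherwise z is kept and the search continues; it cannot run out of entries because x lies
    -- outside the span of `xs`.
    (no x∉′) → pure
      (zs , refl
          , span-⊆ (All.head (span-++ʳ zs (x ∷ xs))
                     ∷ ++⁺ (span-++ˡ zs (x ∷ xs)) (All.tail (span-++ʳ zs (x ∷ xs))))
                   (exchange x∈ x∉′)
            ∷ span-++ˡ zs (x ∷ xs))
    (yes x∈′) → replace zs x∈′ x∉ >>= λ where
      (zs′ , len , zs⊆) → pure (z ∷ zs′ , cong suc len , span-here ∷ All.map span-there zs⊆)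

  -- Start with `ys` as the complement of the empty list; each entry of `xs` then pushes out exactly
  -- one entry, which keeps the total length.
  complement : ∀ {ys} xs → Independent xs → All (Span ys) xs →
               ¬ ¬ ∃ λ zs → length zs + length xs ≡ length ys × All (Span (zs ++ xs)) ys
  complement {ys} [] _ _ = pure (ys , ℕ.+-identityʳ _ , span-++ˡ ys [])
  complement (x ∷ xs) (x∉ , indep) (x∈ ∷ xs⊆) = complement xs indep xs⊆ >>= λ where
    (zs , len , ys⊆) → replace zs (span-⊆ ys⊆ x∈) x∉ >>= λ where
      (zs′ , len′ , zs⊆) → pure
        ( zs′
        , ≡.trans (ℕ.+-suc (length zs′) (length xs)) (≡.trans (cong (_+ length xs) len′) len)
        , All.map (span-⊆ (++⁺ zs⊆ (All.tail (span-++ʳ zs′ (x ∷ xs))))) ys⊆)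

  steinitz : ∀ {xs ys} → Independent xs → All (Span ys) xs → ¬ ¬ (length xs ≤ length ys)
  steinitz {xs} indep xs⊆ = complement xs indep xs⊆ >>= λ where
    (zs , len , _) → pure (≤-trans (m≤n+m (length xs) (length zs)) (≤-reflexive len))

  -- Intersections and sums of flats.

  -- `common` is a basis of ⟨ps⟩ ∩ ⟨bs⟩, and `rest` completes it to the size of a basis of ⟨bs⟩.
  record RelativeBasis (ps bs : List Carrier) : Set (c ⊔ s) where
    field
      common rest        : List Carrier
      lengths            : length rest + length common ≡ length bs
      common⊆ps          : All (Span ps) common
      common⊆bs          : All (Span bs) common
      common-independent : Independent common
      rest⊆bs            : All (Span bs) rest
      rest-independent   : Independent (rest ++ ps)
      bs⊆rest++ps        : All (Span (rest ++ ps)) bs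

  -- Each b lengthens exactly one of the two lists. If b is independent of `rest ++ ps`, it joins
  -- `rest`. Otherwise modularity puts b in the span of `rest` and some d in the span of `ps`; by
  -- exchange d lies in the span of b and `rest`, so d belongs to the intersection and joins
  -- `common`.
  relativeBasis : ∀ {ps} bs → Independent ps → Independent bs → ¬ ¬ RelativeBasis ps bs
  relativeBasis [] indepₚ _ = pure record
    { common = [] ; rest = [] ; lengths = refl
    ; common⊆ps = [] ; common⊆bs = [] ; common-independent = _
    ; rest⊆bs = [] ; rest-independent = indepₚ ; bs⊆rest++ps = [] }
  relativeBasis {ps} (b ∷ bs) indepₚ (b∉ , indep) = relativeBasis bs indepₚ indep >>= λ R →
    let open RelativeBasis R in
    ¬¬-excluded-middle {A = Span (rest ++ ps) b} >>= λ where
      (no b∉′) → pure record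
        { common             = common
        ; rest               = b ∷ rest
        ; lengths            = cong suc lengths
        ; common⊆ps          = common⊆ps
        ; common⊆bs          = All.map span-there common⊆bs
        ; common-independent = common-independent
        ; rest⊆bs            = span-here ∷ All.map span-there rest⊆bs
        ; rest-independent   = b∉′ , rest-independent
        ; bs⊆rest++ps        = span-here ∷ All.map span-there bs⊆rest++ps }
      (yes b∈) →
        let b∉rest         = λ b∈rest → b∉ (span-⊆ rest⊆bs b∈rest)
            d , d∈ps , b∈d = modular rest b∈ b∉rest
        in pure record
        { common             = d ∷ common
        ; rest               = rest
        ; lengths            = ≡.trans (ℕ.+-suc (length rest) (length common)) (cong suc lengths)
        ; common⊆ps          = d∈ps ∷ common⊆ps
        ; common⊆bs          = span-⊆ (span-here ∷ All.map span-there rest⊆bs) (exchange b∈d b∉rest)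
                               ∷ All.map span-there common⊆bs
        -- Were d in the span of `common`, then d, and with `rest` also b, would lie in the span of
        -- `bs`.
        ; common-independent = (λ d∈ → b∉ (span-⊆ (span-⊆ common⊆bs d∈ ∷ rest⊆bs) b∈d))
                             , common-independent
        ; rest⊆bs            = All.map span-there rest⊆bs
        ; rest-independent   = rest-independent
        ; bs⊆rest++ps        = b∈ ∷ bs⊆rest++ps }

  -- The Dyson transform and the dimension bound.

  independent-map-++ : ∀ {s t us ps} cs → s ∙ t ≈ ε → Independent (cs ++ ps) → Independent us →
                       All (λ u → Span ps (u ∙ t)) us → Independent (map (_∙ s) cs ++ us)
  independent-map-++ []       st≈ε _            indepᵤ us⊆ = indepᵤ
  independent-map-++ {ps = ps} (c ∷ cs) st≈ε (c∉ , indep) indepᵤ us⊆ =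
    -- Multiplied by t, a dependency of c s on the remaining entries becomes one of c on `cs ++ ps`,
    -- since t carries `us` into the span of `ps`.
    (λ c∈ → c∉ (span-resp (cancel st≈ε c)
      (span-∙ (++⁺ (map⁺ (All.map (span-resp (≈-sym (cancel st≈ε _))) (span-++ˡ cs ps)))
                   (All.map (span-⊆ (span-++ʳ cs ps)) us⊆)) c∈)))
    , independent-map-++ cs st≈ε indep indepᵤ us⊆

  -- That an injection A → A is onto is a count here: if x were outside the span of the translated
  -- generators `zs`, then `x ∷ zs` would be an independent list in A longer than its basis
  -- `x ∷ us`.
  unstable : ∀ {us vs ws x y y⁻¹ v v⁻¹} → Independent (x ∷ us) → y ∙ y⁻¹ ≈ ε → v ∙ v⁻¹ ≈ ε →
             (∀ {a b} → Span (x ∷ us) a → Span vs b → Span ws (a ∙ b)) → Span vs v →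
             ¬ Span ws (x ∙ y) → ¬ All (λ e → Span (x ∷ us) (e ∙ (y⁻¹ ∙ v))) (x ∷ us)
  unstable {us} {vs} {ws} {x} {y} {y⁻¹} {v} {v⁻¹} indep yy≈ε vv≈ε mult v∈ xy∉ stable =
    ¬¬-excluded-middle {A = Span zs x} λ where
      (yes x∈) → xy∉ (span-∙ (map⁺ (All.map
        (λ e∈ → span-resp (regroup _) (mult e∈ v∈)) (span-refl (x ∷ us)))) x∈)
      (no x∉) → steinitz {x ∷ zs} {x ∷ us} (x∉ , independent-map (x ∷ us) tt≈ε indep)
                  (span-here ∷ map⁺ stable)
                  λ le → 1+n≰n (≤-trans (s≤s (≤-reflexive (≡.sym (length-map _ (x ∷ us))))) le)
    where
    zs = map (_∙ (y⁻¹ ∙ v)) (x ∷ us)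
    tt≈ε : (y⁻¹ ∙ v) ∙ (y ∙ v⁻¹) ≈ ε
    tt≈ε = ≈-trans (interchange y⁻¹ v y v⁻¹)
             (≈-trans (∙-cong (≈-trans (comm y⁻¹ y) yy≈ε) vv≈ε) (identityˡ ε))
    regroup : ∀ e → e ∙ v ≈ (e ∙ (y⁻¹ ∙ v)) ∙ y
    regroup e = ≈-sym (≈-trans (assoc e _ y) (∙-congˡ
      (≈-trans (xy∙z≈y∙zx y⁻¹ v y) (≈-trans (∙-congˡ yy≈ε) (identityʳ v)))))

  -- The bound n on the length of `vs` carries the recursion, because the transformed V is given by
  -- a new list and not by a sublist of `vs`.
  sumset-bound : ∀ n {us vs ws x y y⁻¹} → length vs ≤ n → y ∙ y⁻¹ ≈ ε →
    Independent us → Independent vs →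
    (∀ {a} → Span us a → Span ws (a ∙ y)) →
    (∀ {a b} → Span (x ∷ us) a → Span vs b → Span ws (a ∙ b)) →
    ¬ Span ws (x ∙ y) → ¬ ¬ (length us + length vs ≤ length ws)
  sumset-bound n {us} {[]} {ws} {y = y} _ yy≈ε indepᵤ _ mult-y _ _ =
    -- For V = 0 it remains that dim U ≤ dim W, which follows from U y ⊆ W as y is invertible.
    steinitz (independent-map us yy≈ε indepᵤ) (map⁺ (All.map mult-y (span-refl us))) >>= λ le →
    pure (subst (_≤ length ws) (≡.trans (length-map _ us) (≡.sym (ℕ.+-identityʳ _))) le)
  sumset-bound (suc n) {us} {vs@(v ∷ _)} {ws} {x} {y} {y⁻¹} len yy≈ε indepᵤ indepᵥ mult-y mult xy∉ =
    -- One v in V suffices: the generator e of A found here has e v / y outside A.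
    ¬All⇒¬¬Any¬ (x ∷ us)
      (unstable indep yy≈ε (proj₂ (invertible (proj₁ indepᵥ ∘ span-[]))) mult span-here xy∉)
    >>= λ any →
    let e≠0 , e∉ = All.lookupAny (nonzero (x ∷ us) indep) any
    in transform (proj₁ (All.lookupAny (span-refl (x ∷ us)) any)) (proj₂ (invertible e≠0)) e∉
    where
    indep : Independent (x ∷ us)
    indep = (λ x∈ → xy∉ (mult-y x∈)) , indepᵤ

    transform : ∀ {e e⁻¹} → Span (x ∷ us) e → e ∙ e⁻¹ ≈ ε → ¬ Span (x ∷ us) (e ∙ (y⁻¹ ∙ v)) →
                ¬ ¬ (length us + length vs ≤ length ws)
    transform {e} {e⁻¹} e∈ ee≈ε ev∉ =
      relativeBasis vs (independent-map (x ∷ us) t⁻¹t≈ε indep) indepᵥ >>= step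
      where
      -- This t satisfies t y = e, so V t y = e V stays inside A V ⊆ W.
      t   = y⁻¹ ∙ e
      t⁻¹ = y ∙ e⁻¹
      tt⁻¹≈ε : t ∙ t⁻¹ ≈ ε
      tt⁻¹≈ε = ≈-trans (interchange y⁻¹ e y e⁻¹)
                 (≈-trans (∙-cong (≈-trans (comm y⁻¹ y) yy≈ε) ee≈ε) (identityˡ ε))
      t⁻¹t≈ε : t⁻¹ ∙ t ≈ ε
      t⁻¹t≈ε = ≈-trans (comm t⁻¹ t) tt⁻¹≈ε

      step : RelativeBasis (map (_∙ t⁻¹) (x ∷ us)) vs → ¬ ¬ (length us + length vs ≤ length ws)
      -- An empty `rest` would put v in A / t, that is, e v / y in A, against the choice of e.
      step record { rest = [] ; bs⊆rest++ps = v∈ ∷ _ } =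
        contradiction (span-resp (x∙yz≈z∙yx v y⁻¹ e) (span-unmap t⁻¹t≈ε v∈)) ev∉
      step R@record { rest = c ∷ cs } =
        sumset-bound n {us′} {common} {ws} {x} {y}
          -- As `rest` has the entry c, `common` is strictly shorter than `vs`.
          (≤-trans (m≤n+m _ (length cs)) (s≤s⁻¹ (≤-trans (≤-reflexive lengths) len)))
          yy≈ε
          (independent-map-++ (c ∷ cs) tt⁻¹≈ε rest-independent indepᵤ
            (All.map (λ u∈ → span-map t⁻¹ (span-there u∈)) (span-refl us)))
          common-independent
          (span-∙ (++⁺ (map⁺ (All.map cty∈ rest⊆bs)) (All.map mult-y (span-refl us))))
          -- The new A is generated by x, by the c t with c in `rest`, and by `us`; the first and
          -- last kinds are covered by the old inclusion, as `common` lies in V.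
          (λ a∈ b∈ → span-∙
            (mult span-here (span-⊆ common⊆bs b∈)
             ∷ ++⁺ (map⁺ (All.map (λ c∈ → ctb∈ c∈ b∈) rest⊆bs))
                   (All.map (λ u∈ → mult (span-there u∈) (span-⊆ common⊆bs b∈)) (span-refl us)))
            a∈)
          xy∉
        >>= λ le → pure (subst (_≤ length ws) lengths′ le)
        where
        open RelativeBasis R
        -- Only `rest` is translated into U: it is independent modulo A / t, so its translate is
        -- independent modulo A, and the new dimensions add up to the old sum.
        us′ = map (_∙ t) (c ∷ cs) ++ us

        cty∈ : ∀ {c} → Span vs c → Span ws ((c ∙ t) ∙ y)
        cty∈ {c} c∈ = span-resp
          (≈-trans (comm e c) (≈-sym (≈-trans (assoc c t y) (∙-congˡ
            (≈-trans (xy∙z≈y∙zx y⁻¹ e y) (≈-trans (∙-congˡ yy≈ε) (identityʳ e)))))))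
          (mult e∈ c∈)

        -- Regroup as (b t) c: the span of `common` lies in A / t, so b t is in A and the old
        -- inclusion A V ⊆ W applies.
        ctb∈ : ∀ {c b} → Span vs c → Span common b → Span ws ((c ∙ t) ∙ b)
        ctb∈ {c} {b} c∈ b∈ = span-resp (≈-sym (xy∙z≈zy∙x c t b))
          (mult (span-unmap t⁻¹t≈ε (span-⊆ common⊆ps b∈)) c∈)

        lengths′ : length us′ + length common ≡ length us + length vs
        lengths′ = ≡.trans (cong (_+ length common) (≡.trans (length-++ (map (_∙ t) (c ∷ cs)))
            (≡.trans (cong (_+ length us) (length-map _ (c ∷ cs))) (ℕ.+-comm _ (length us)))))
          (≡.trans (ℕ.+-assoc (length us) _ _) (cong (length us +_) lengths))

  -- Flags and their corners.

  record SpannedFlag {p} (n : ℕ) (F : ℕ → Pred Carrier p) : Set (c ⊔ ℓ ⊔ s ⊔ p) where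
    field
      -- Cardinality i + 1 in a group and dimension i + 1 over a field both take this form.
      basis       : ∀ i → i < n → ∃ λ xs →
                    length xs ≡ suc i × Independent xs × (∀ x → F i x ⇔ Span xs x)
      nested      : ∀ i → suc i < n → ∀ x → F i x → F (suc i) x
      top         : ∀ x → F (n ∸ 1) x

  module _ {p n} {F : ℕ → Pred Carrier p} (flag : SpannedFlag n F) where
    open SpannedFlag flag
    open Equivalence

    Prod : ℕ → ℕ → ℕ → Set (c ⊔ p)
    Prod i j k = ∀ x y → F i x → F j y → F k (x ∙ y)

    monotone : ∀ {k l x} → k ≤ l → l < n → F k x → F l x
    monotone {k} {zero}  z≤n _ x∈ = x∈
    monotone {k} {suc l} k≤l l<n x∈ with m≤n⇒m<n∨m≡n k≤l
    ... | inj₁ k<l = nested l l<n _ (monotone (s≤s⁻¹ k<l) (<-trans (n<1+n l) l<n) x∈)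
    ... | inj₂ refl = x∈

    -- This is the least number principle; `Prod` is not decidable, so the minimum exists only up to
    -- double negation.
    flagType : ∀ i j {m} → m < n → Prod i j m → ¬ ¬ ∃ (IsFlagType Prod n i j)
    flagType i j m<n prod ¬type = <-rec (λ k → k < n → ¬ Prod i j k)
      (λ k rec k<n prodₖ → ¬type (k , k<n , prodₖ , λ k′ k′<k → rec k′<k (<-trans k′<k k<n)))
      _ m<n prod

    -- The corner condition speaks of every value of T, so it has content only once a value exists;
    -- the index n - 1 works because the last member of the flag is everything.
    flagType-bound : ∀ i j {k} → k < n → (∀ k₁ → IsFlagType Prod n i j k₁ → k₁ < k) →
                     ¬ ¬ ∃ λ k₁ → k₁ < k × Prod i j k₁
    flagType-bound i j k<n below = flagType i j (n∸1<n k<n) (λ _ _ _ _ → top _) >>= λ where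
        (k₁ , type) → pure (k₁ , below k₁ type , proj₁ (proj₂ type))
      where
      n∸1<n : ∀ {k n} → k < n → n ∸ 1 < n
      n∸1<n {n = suc n} _ = n<1+n n

    corner-bound : ∀ i j k → IsCorner Prod n i j k → i + j ≤ k
    corner-bound (suc i) (suc j) k (_ , i<n , _ , j<n , (k<n , _ , least) , left , below) =
      decidable-stable (_ ≤? _)
        (flagType-bound i (suc j) k<n left >>= λ where
          (k₁ , k₁<k , prod₁) → flagType-bound (suc i) j k<n below >>= λ where
            (k₂ , k₂<k , prod₂) → bound k<n least k₁<k prod₁ k₂<k prod₂)
      where
      i⁻<n = <-trans (n<1+n i) i<n
      j⁻<n = <-trans (n<1+n j) j<n

      bound : ∀ {k k₁ k₂} → k < n → (∀ k′ → k′ < k → ¬ Prod (suc i) (suc j) k′) →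
              k₁ < k → Prod i (suc j) k₁ → k₂ < k → Prod (suc i) j k₂ →
              ¬ ¬ (suc i + suc j ≤ k)
      -- In these shifted indices the corner is (`suc i`, `suc j`) with value `suc k`, and U, V, W
      -- are F i, F j, F k, of dimensions i + 1, j + 1, k + 1: the dimension bound is literally the
      -- claim.
      bound {suc k} k<n least k₁<k prod₁ k₂<k prod₂
        with basis i i⁻<n | basis j j⁻<n | basis k (<-trans (n<1+n k) k<n)
           | basis (suc i) i<n | basis (suc j) j<n
      ... | us , |us| , indepᵤ , span-us | vs , |vs| , indepᵥ , span-vs
          | ws , |ws| , _ , span-ws
          | xs , _ , _ , span-xs | ys , _ , _ , span-ys =
        ¬All⇒¬¬Any¬ xs (λ xsys⊆ → least k (n<1+n k) λ a b a∈ b∈ →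
          from (span-ws _) (span-∙∙ xsys⊆ (to (span-xs a) a∈) (to (span-ys b) b∈))) >>= λ anyₓ →
        let x∈ , ¬all = All.lookupAny (span-refl xs) anyₓ in
        ¬All⇒¬¬Any¬ ys ¬all >>= λ anyᵧ →
        let y∈ , xy∉ = All.lookupAny (span-refl ys) anyᵧ in
        go (from (span-xs _) x∈) (from (span-ys _) y∈) xy∉
        where
        k⁻<n = <-trans (n<1+n k) k<n

        go : ∀ {x y} → F (suc i) x → F (suc j) y → ¬ Span ws (x ∙ y) →
             ¬ ¬ (suc i + suc j ≤ suc k)
        go {x} {y} x∈ y∈ xy∉ =
          sumset-bound (length vs) ≤-refl (proj₂ (invertible y≠0)) indepᵤ indepᵥ
            (λ a∈ → into (s≤s⁻¹ k₁<k) (prod₁ _ _ (from (span-us _) a∈) y∈))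
            (λ a∈ b∈ → into (s≤s⁻¹ k₂<k)
              (prod₂ _ _ (from (span-xs _) (span-⊆ (to (span-xs x) x∈ ∷ us⊆xs) a∈))
                         (from (span-vs _) b∈)))
            xy∉ >>= λ le →
          pure (subst (_≤ suc k) (≡.cong₂ _+_ |us| |vs|) (subst (_ ≤_) |ws| le))
          where
          into : ∀ {l z} → l ≤ k → F l z → Span ws z
          into l≤k z∈ = to (span-ws _) (monotone l≤k k⁻<n z∈)
          us⊆xs : All (Span xs) us
          us⊆xs = All.map (λ u∈ → to (span-xs _) (nested i i<n _ (from (span-us _) u∈)))
                          (span-refl us)
          -- If y were 0, then x y = 0 would lie in W.
          y≠0 : ¬ Span [] y
          y≠0 y∈[] = xy∉ (span-resp (comm y x) (span-[] (span-map x y∈[])))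

-- Finite abelian groups.

module _ {c ℓ} (G : AbelianGroup c ℓ) where
  open AbelianGroup G renaming (refl to ≈-refl; sym to ≈-sym; trans to ≈-trans)

  groupSpan : SpanStructure commutativeMonoid (c ⊔ ℓ)
  groupSpan = record
    { Span       = λ xs x → Any (x ≈_) xs
    ; span-resp  = λ x≈y → Any.map (≈-trans (≈-sym x≈y))
    ; span-here  = here ≈-refl
    ; span-there = there
    ; span-⊆     = span-⊆
    ; exchange   = λ where
        (here x≈y)  _  → here (≈-sym x≈y)
        (there x∈) x∉ → contradiction x∈ x∉
    ; modular    = λ xs x∈ x∉ → modular (Anyₚ.++⁻ xs x∈) x∉
    ; span-map   = λ t → Anyₚ.map⁺ ∘ Any.map ∙-congʳ
    ; invertible = λ {x} _ → x ⁻¹ , inverseʳ x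
    }
    where
    span-⊆ : ∀ {xs ys z} → All (λ x → Any (x ≈_) ys) xs → Any (z ≈_) xs → Any (z ≈_) ys
    span-⊆ (x∈ ∷ _)  (here z≈x) = Any.map (≈-trans z≈x) x∈
    span-⊆ (_ ∷ xs⊆) (there z∈) = span-⊆ xs⊆ z∈

    modular : ∀ {xs ys x} → Any (x ≈_) xs ⊎ Any (x ≈_) ys → ¬ Any (x ≈_) xs →
              ∃ λ y → Any (y ≈_) ys × Any (x ≈_) (y ∷ xs)
    modular (inj₁ x∈) x∉ = contradiction x∈ x∉
    modular (inj₂ x∈) _  = _ , x∈ , here ≈-refl

  tabulate-independent : ∀ {m} (e : Fin m → Carrier) → (∀ a b → e a ≈ e b → a ≡ b) →
                         Independent groupSpan (tabulate e)
  tabulate-independent {zero}  e inj = _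
  tabulate-independent {suc m} e inj =
    (λ e₀∈ → let _ , e₀≈ = Anyₚ.tabulate⁻ e₀∈ in 0≢1+n (inj _ _ e₀≈))
    , tabulate-independent (e ∘ fsuc) (λ a b → suc-injective ∘ inj _ _)

  groupFlag : ∀ {p n} {F : ℕ → Pred Carrier p} → IsGroupFlag G n F → SpannedFlag groupSpan n F
  groupFlag flag = record
    { basis  = λ i i<n → let e , inj , F⇔ = card i i<n in
        tabulate e , length-tabulate e , tabulate-independent e inj ,
        λ x → mk⇔ (λ x∈ → let a , x≈ = to (F⇔ x) x∈ in Anyₚ.tabulate⁺ {f = e} a x≈)
                  (from (F⇔ x) ∘ Anyₚ.tabulate⁻)
    ; nested = nested
    ; top    = top
    }
    where
    open IsGroupFlag flag
    open Equivalence

-- Field extensions.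

module _ {c ℓ q} (L : CommutativeRing c ℓ) (isField : IsField L)
         (K : Pred (CommutativeRing.Carrier L) q) (subfield : IsSubfield L K) where
  open CommutativeRing L renaming (_+_ to _⊕_; refl to ≈-refl; sym to ≈-sym; trans to ≈-trans)
  open import Algebra.Properties.CommutativeSemigroup +-commutativeSemigroup
    using (interchange; x∙yz≈y∙xz)
  open import Algebra.Properties.Ring ring using (-‿distribˡ-*; -1*x≈-x; -0#≈0#; -‿involutive)
  open import Relation.Binary.Reasoning.Setoid setoid
  open IsSubfield subfield

  -- Combinations follow the list, and equality enters through an argument of each constructor, so
  -- proofs recurse on the list without vectors of coefficients.
  data LinearSpan : List Carrier → Carrier → Set (c ⊔ ℓ ⊔ q) where
    nil  : ∀ {z} → z ≈ 0# → LinearSpan [] z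
    cons : ∀ {x xs z} k y → K k → LinearSpan xs y → z ≈ k * x ⊕ y → LinearSpan (x ∷ xs) z

  linear-resp : ∀ {xs x y} → x ≈ y → LinearSpan xs x → LinearSpan xs y
  linear-resp x≈y (nil x≈0)            = nil (≈-trans (≈-sym x≈y) x≈0)
  linear-resp x≈y (cons k w k∈ w∈ eq) = cons k w k∈ w∈ (≈-trans (≈-sym x≈y) eq)

  linear-there : ∀ {x xs y} → LinearSpan xs y → LinearSpan (x ∷ xs) y
  linear-there {x} {y = y} y∈ =
    cons 0# y zero∈ y∈ (≈-sym (≈-trans (+-congʳ (zeroˡ x)) (+-identityˡ y)))

  linear-0 : ∀ xs → LinearSpan xs 0#
  linear-0 []       = nil ≈-refl
  linear-0 (x ∷ xs) = linear-there (linear-0 xs)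

  linear-here : ∀ {x xs} → LinearSpan (x ∷ xs) x
  linear-here {x} {xs} =
    cons 1# 0# one∈ (linear-0 xs) (≈-sym (≈-trans (+-identityʳ _) (*-identityˡ x)))

  linear-+ : ∀ {xs x y} → LinearSpan xs x → LinearSpan xs y → LinearSpan xs (x ⊕ y)
  linear-+ (nil x≈0) (nil y≈0) = nil (≈-trans (+-cong x≈0 y≈0) (+-identityˡ 0#))
  linear-+ {z ∷ _} {x} {y} (cons k v k∈ v∈ x≈) (cons l w l∈ w∈ y≈) =
    cons (k ⊕ l) (v ⊕ w) (+∈ k∈ l∈) (linear-+ v∈ w∈) (begin
      x ⊕ y                      ≈⟨ +-cong x≈ y≈ ⟩
      (k * z ⊕ v) ⊕ (l * z ⊕ w)  ≈⟨ interchange (k * z) v (l * z) w ⟩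
      (k * z ⊕ l * z) ⊕ (v ⊕ w)  ≈⟨ +-congʳ (distribʳ z k l) ⟨
      (k ⊕ l) * z ⊕ (v ⊕ w)      ∎)

  linear-* : ∀ {xs k x} → K k → LinearSpan xs x → LinearSpan xs (k * x)
  linear-* {k = k} k∈ (nil x≈0) = nil (≈-trans (*-congˡ x≈0) (zeroʳ k))
  linear-* {z ∷ _} {k} {x} k∈ (cons l w l∈ w∈ x≈) =
    cons (k * l) (k * w) (*∈ k∈ l∈) (linear-* k∈ w∈) (begin
      k * x                ≈⟨ *-congˡ x≈ ⟩
      k * (l * z ⊕ w)      ≈⟨ distribˡ k (l * z) w ⟩
      k * (l * z) ⊕ k * w  ≈⟨ +-congʳ (*-assoc k l z) ⟨
      k * l * z ⊕ k * w    ∎)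

  linear-⊆ : ∀ {xs ys z} → All (LinearSpan ys) xs → LinearSpan xs z → LinearSpan ys z
  linear-⊆ {ys = ys} [] (nil z≈0)      = linear-resp (≈-sym z≈0) (linear-0 ys)
  linear-⊆ (x∈ ∷ xs⊆) (cons k w k∈ w∈ z≈) =
    linear-resp (≈-sym z≈) (linear-+ (linear-* k∈ x∈) (linear-⊆ xs⊆ w∈))

  -- In x = k y + w the coefficient k is nonzero, as otherwise x = w; hence y = (x - w) / k.
  linear-exchange : ∀ {x y xs} → LinearSpan (y ∷ xs) x → ¬ LinearSpan xs x → LinearSpan (x ∷ xs) y
  linear-exchange {x} {y} {xs} (cons k w k∈ w∈ x≈) x∉ =
    let j , j∈ , kj≈1 = inv∈ k∈ k≉0 in
    cons j (- j * w) j∈ (linear-* (-∈ j∈) w∈) (≈-sym (begin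
      j * x ⊕ - j * w                  ≈⟨ +-congʳ (*-congˡ x≈) ⟩
      j * (k * y ⊕ w) ⊕ - j * w        ≈⟨ +-congʳ (distribˡ j (k * y) w) ⟩
      (j * (k * y) ⊕ j * w) ⊕ - j * w  ≈⟨ +-assoc _ _ _ ⟩
      j * (k * y) ⊕ (j * w ⊕ - j * w)  ≈⟨ +-cong (*-assoc j k y) (distribʳ w j (- j)) ⟨
      j * k * y ⊕ (j ⊕ - j) * w        ≈⟨ +-cong (*-congʳ (≈-trans (*-comm j k) kj≈1))
                                                 (*-congʳ (-‿inverseʳ j)) ⟩
      1# * y ⊕ 0# * w                  ≈⟨ +-cong (*-identityˡ y) (zeroˡ w) ⟩
      y ⊕ 0#                           ≈⟨ +-identityʳ y ⟩
      y                                ∎))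
    where
    k≉0 : ¬ (k ≈ 0#)
    k≉0 k≈0 = x∉ (linear-resp (begin
      w           ≈⟨ +-identityˡ w ⟨
      0# ⊕ w      ≈⟨ +-congʳ (≈-trans (*-congʳ k≈0) (zeroˡ y)) ⟨
      k * y ⊕ w   ≈⟨ x≈ ⟨
      x           ∎) w∈)

  -- The witness y is the part of the combination carried by `ys`.
  linear-modular : ∀ xs {ys x} → LinearSpan (xs ++ ys) x →
                   ∃ λ y → LinearSpan ys y × LinearSpan (y ∷ xs) x
  linear-modular []       {x = x} x∈ = x , x∈ , linear-here
  linear-modular (z ∷ xs) {x = x} (cons k w k∈ w∈ x≈) with linear-modular xs w∈
  ... | y , y∈ , cons l v l∈ v∈ w≈ =
    y , y∈ , cons l (k * z ⊕ v) l∈ (cons k v k∈ v∈ ≈-refl) (begin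
      x                    ≈⟨ x≈ ⟩
      k * z ⊕ w            ≈⟨ +-congˡ w≈ ⟩
      k * z ⊕ (l * y ⊕ v)  ≈⟨ x∙yz≈y∙xz (k * z) (l * y) v ⟩
      l * y ⊕ (k * z ⊕ v)  ∎)

  linear-map : ∀ {xs x} t → LinearSpan xs x → LinearSpan (map (_* t) xs) (x * t)
  linear-map t (nil x≈0) = nil (≈-trans (*-congʳ x≈0) (zeroˡ t))
  linear-map {z ∷ _} {x} t (cons k w k∈ w∈ x≈) = cons k (w * t) k∈ (linear-map t w∈) (begin
    x * t                ≈⟨ *-congʳ x≈ ⟩
    (k * z ⊕ w) * t      ≈⟨ distribʳ t (k * z) w ⟩
    k * z * t ⊕ w * t    ≈⟨ +-congʳ (*-assoc k z t) ⟩
    k * (z * t) ⊕ w * t  ∎)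

  linearSpan : SpanStructure *-commutativeMonoid (c ⊔ ℓ ⊔ q)
  linearSpan = record
    { Span       = LinearSpan
    ; span-resp  = linear-resp
    ; span-here  = linear-here
    ; span-there = linear-there
    ; span-⊆     = linear-⊆
    ; exchange   = linear-exchange
    ; modular    = λ xs x∈ _ → linear-modular xs x∈
    ; span-map   = linear-map
    ; invertible = λ x∉ → proj₂ isField _ (x∉ ∘ nil)
    }

  lincomb⇒span : ∀ {d x} (cs v : Fin d → Carrier) → (∀ m → K (cs m)) → x ≈ lincomb L d cs v →
                 LinearSpan (tabulate v) x
  lincomb⇒span {zero}  cs v cs∈ x≈ = nil x≈
  lincomb⇒span {suc d} cs v cs∈ x≈ =
    cons (cs fzero) _ (cs∈ fzero) (lincomb⇒span (cs ∘ fsuc) (v ∘ fsuc) (cs∈ ∘ fsuc) ≈-refl) x≈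

  span⇒lincomb : ∀ {d x} (v : Fin d → Carrier) → LinearSpan (tabulate v) x →
                 ∃ λ cs → (∀ m → K (cs m)) × x ≈ lincomb L d cs v
  span⇒lincomb {zero}  v (nil x≈0) = (λ ()) , (λ ()) , x≈0
  span⇒lincomb {suc d} v (cons k y k∈ y∈ x≈) =
    let cs , cs∈ , y≈ = span⇒lincomb (v ∘ fsuc) y∈ in
    (λ { fzero → k ; (fsuc m) → cs m }) , (λ { fzero → k∈ ; (fsuc m) → cs∈ m }) ,
    ≈-trans x≈ (+-congˡ y≈)

  basis-independent : ∀ {d} (v : Fin d → Carrier) →
    (∀ cs → (∀ m → K (cs m)) → lincomb L d cs v ≈ 0# → ∀ m → cs m ≈ 0#) →
    Independent linearSpan (tabulate v)
  basis-independent {zero}  v indep = _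
  basis-independent {suc d} v indep = head∉ , basis-independent (v ∘ fsuc) λ cs cs∈ eq m →
      indep (λ { fzero → 0# ; (fsuc m) → cs m }) (λ { fzero → zero∈ ; (fsuc m) → cs∈ m })
        (≈-trans (+-cong (zeroˡ _) eq) (+-identityˡ 0#)) (fsuc m)
    where
    head∉ : ¬ LinearSpan (tabulate (v ∘ fsuc)) (v fzero)
    head∉ v₀∈ =
      let cs , cs∈ , v₀≈ = span⇒lincomb (v ∘ fsuc) v₀∈
          -- Moving the head to the other side gives a relation in which it has coefficient -1.
          -1≈0 = indep (λ { fzero → - 1# ; (fsuc m) → cs m })
                   (λ { fzero → -∈ one∈ ; (fsuc m) → cs∈ m })
                   (≈-trans (+-cong (-1*x≈-x _) (≈-sym v₀≈)) (-‿inverseˡ _)) fzero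
      in proj₁ isField (≈-trans (≈-sym (-‿involutive 1#)) (≈-trans (-‿cong -1≈0) -0#≈0#))

  fieldFlag : ∀ {p n} {F : ℕ → Pred Carrier p} → IsFieldFlag L K n F → SpannedFlag linearSpan n F
  fieldFlag flag = record
    { basis  = λ i i<n → let v , v∈ , indep , spanning = dim i i<n in
        tabulate v , length-tabulate v , basis-independent v indep ,
        λ x → mk⇔
          (λ x∈ → let cs , cs∈ , x≈ = spanning x x∈ in lincomb⇒span cs v cs∈ x≈)
          (span⊆ (subspace i i<n) (Allₚ.tabulate⁺ v∈))
    ; nested = nested
    ; top    = top
    }
    where
    open IsFieldFlag flag

    span⊆ : ∀ {p} {V : Pred Carrier p} {xs z} → IsSubspace L K V → All V xs → LinearSpan xs z → V z
    span⊆ V [] (nil z≈0) = IsSubspace.resp V (≈-sym z≈0) (IsSubspace.zero∈ V)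
    span⊆ V (x∈ ∷ xs⊆) (cons k w k∈ w∈ z≈) = IsSubspace.resp V (≈-sym z≈)
      (IsSubspace.+∈ V (IsSubspace.smul∈ V k∈ x∈) (span⊆ V xs⊆ w∈))

theorem1p24 : ∀ {c ℓ p c′ ℓ′ q p′} →
    (∀ (G : AbelianGroup c ℓ) (n : ℕ) → HasOrder G n →
    (F : ℕ → Pred (AbelianGroup.Carrier G) p) → IsGroupFlag G n F →
    ∀ i j k → IsCorner (GProd G F) n i j k → i + j ≤ k)
    ×
    (∀ (L : CommutativeRing c′ ℓ′) → IsField L →
    (K : Pred (CommutativeRing.Carrier L) q) → IsSubfield L K →
    (n : ℕ) → HasDim L K (Univ L) n →
    (F : ℕ → Pred (CommutativeRing.Carrier L) p′) → IsFieldFlag L K n F →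
    ∀ i j k → IsCorner (FProd L F) n i j k → i + j ≤ k)
theorem1p24 =
  (λ G n _ F flag → corner-bound (groupSpan G) (groupFlag G flag)) ,
  (λ L isField K subfield n _ F flag →
     corner-bound (linearSpan L isField K subfield) (fieldFlag L isField K subfield flag))
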